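{- For all integers $q \ge 3$ and $n \ge 3$, the set $\mathcal{CBFS}_q(n) = \mathcal{A}_q(n) \cup \mathcal{B}_q(n) \cup \mathcal{C}_q(n)$ is a non-expandable cross-bifix-free set on $BF_q(n)$; that is, $\mathcal{CBFS}_q(n)$ is a cross-bifix-free set, and for every $w \in BF_q(n) \setminus \mathcal{CBFS}_q(n)$ the set $\mathcal{CBFS}_q(n) \cup \{w\}$ is not a cross-bifix-free set.
   Context: Words. $\mathbb{Z}_q = \{0,1,\dots,q-1\}$ is an alphabet of $q$ letters and $\mathbb{Z}_q^n$ is the set of words of length $n$ over it. A word $w \in \mathbb{Z}_q^n$ is bifix-free if no non-empty proper prefix of $w$ is also a suffix of $w$. $BF_q(n)$ is the set of all bifix-free words in $\mathbb{Z}_q^n$. Two distinct words $w,w' \in BF_q(n)$ are cross-bifix-free if no non-empty strict (proper) prefix of $w$ is a suffix of $w'$ and no non-empty strict prefix of $w'$ is a suffix of $w$. A subset of $BF_q(n)$ is a cross-bifix-free set if any two distinct words in it are cross-bifix-free. A cross-bifix-free set on $BF_q(n)$ is non-expandable if the set obtained by adding to it any other word of $BF_q(n)$ is not a cross-bifix-free set. Motzkin words. Words are read as lattice paths starting at $(0,0)$: the letter $0$ is a fall step $(1,-1)$, the letter $1$ is a rise step $(1,1)$, and each of the letters $2,\dots,q-1$ is a level step $(1,0)$ carrying one of $q-2$ colors (distinct letters, distinct colors). $\mathcal{M}_{q-2}(m)$ denotes the set of $(q-2)$-colored Motzkin words of length $m \ge 0$: the words in $\mathbb{Z}_q^m$ whose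 path ends at $(m,0)$ and never goes below the $x$-axis (for $m=0$, only the empty word). For $m \ge 2$, the set of elevated $(q-2)$-colored Motzkin words of length $m$ is $\hat{\mathcal{M}}_{q-2}(m) = \{1\alpha 0 : \alpha \in \mathcal{M}_{q-2}(m-2)\}$. The sets. For $q\ge 3$, $n \ge 3$ (juxtaposition is concatenation): $\mathcal{A}_q(n) = \{\alpha\beta : \alpha \in \mathcal{M}_{q-2}(i),\ \beta \in \hat{\mathcal{M}}_{q-2}(n-i),\ 0 \le i \le \lfloor n/2 \rfloor\} \setminus \{\alpha\beta : \alpha,\beta \in \hat{\mathcal{M}}_{q-2}(n/2)\}$, where the removed set is taken to be empty if $n$ is odd; $\mathcal{B}_q(n) = \{1\alpha\beta : \alpha \in \mathcal{M}_{q-2}(i),\ \beta \in \hat{\mathcal{M}}_{q-2}(n-i-1),\ 0 \le i \le \lfloor n/2 \rfloor - 1\}$; $\mathcal{C}_q(n)$ is the set of words $\gamma 0$ with $\gamma \in \mathcal{M}_{q-2}(n-1)$ such that $\gamma$ cannot be written as $\gamma = u\beta v$ with $u,v$ (possibly empty) words and $\beta \in \hat{\mathcal{M}}_{q-2}(j)$ for some $j \ge \lceil n/2 \rceil$. -}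

module Defs where

open import Data.Fin.Base using (Fin; zero; suc; fromℕ<)
open import Data.Integer.Base as ℤ using (ℤ; 0ℤ; 1ℤ; -1ℤ)
open import Data.List.Base using (List; []; _∷_; _++_; [_]; length; map; foldr)
open import Data.List.Relation.Binary.Prefix.Heterogeneous using (Prefix)
open import Data.List.Relation.Binary.Suffix.Heterogeneous using (Suffix)
open import Data.Nat.Base using (ℕ; _+_; _∸_; _≤_; ⌊_/2⌋; ⌈_/2⌉; s≤s; z≤n)
open import Data.Nat.Properties using (≤-trans)
open import Data.Product.Base using (∃-syntax; _×_)
open import Level using (0ℓ)
open import Relation.Binary.PropositionalEquality.Core using (_≡_; _≢_)
open import Relation.Nullary.Negation.Core using (¬_)
open import Relation.Unary using (Pred; _∈_; _⊆_; _∪_; _∖_; ｛_｝)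

-- Words over the alphabet {0, …, q-1}; sets of words of length n are
-- predicates on words that enforce the length.
Word : ℕ → Set
Word q = List (Fin q)

WordSet : ℕ → Set₁
WordSet q = Pred (Word q) 0ℓ

-- No non-empty proper prefix of the first word is a suffix of the second.
NoOverlap : ∀ {q} → Word q → Word q → Set
NoOverlap w w′ = ∀ u → u ≢ [] → Prefix _≡_ u w → u ≢ w → ¬ Suffix _≡_ u w′

BifixFree : ∀ {q} → WordSet q
BifixFree w = NoOverlap w w

BF : ∀ q → ℕ → WordSet q
BF q n w = length w ≡ n × BifixFree w

CrossBifixFree : ∀ {q} → Word q → Word q → Set
CrossBifixFree w w′ = NoOverlap w w′ × NoOverlap w′ w

IsCrossBifixFreeSet : ∀ q → ℕ → WordSet q → Set
IsCrossBifixFreeSet q n S =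
  S ⊆ BF q n × (∀ w w′ → w ∈ S → w′ ∈ S → w ≢ w′ → CrossBifixFree w w′)

IsNonExpandableCrossBifixFreeSet : ∀ q → ℕ → WordSet q → Set
IsNonExpandableCrossBifixFreeSet q n S =
  IsCrossBifixFreeSet q n S ×
  (∀ w → w ∈ BF q n ∖ S → ¬ IsCrossBifixFreeSet q n (S ∪ ｛ w ｝))

-- Vertical displacement of a letter: 0 falls, 1 rises, and each of the q - 2
-- remaining letters is a level step of its own colour.
step : ∀ {q} → Fin q → ℤ
step zero          = -1ℤ
step (suc zero)    = 1ℤ
step (suc (suc _)) = 0ℤ

height : ∀ {q} → Word q → ℤ
height w = foldr ℤ._+_ 0ℤ (map step w)

-- (q - 2)-coloured Motzkin words of length m.
Motzkin : ∀ q → ℕ → WordSet q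
Motzkin q m w =
  length w ≡ m × height w ≡ 0ℤ × (∀ u → Prefix _≡_ u w → 0ℤ ℤ.≤ height u)

module Construction (q : ℕ) (3≤q : 3 ≤ q) where

  𝟎 𝟏 : Fin q
  𝟎 = fromℕ< (≤-trans (s≤s z≤n) 3≤q)
  𝟏 = fromℕ< (≤-trans (s≤s (s≤s z≤n)) 3≤q)

  ElevatedMotzkin : ℕ → WordSet q
  ElevatedMotzkin m w =
    2 ≤ m × ∃[ α ] α ∈ Motzkin q (m ∸ 2) × w ≡ 𝟏 ∷ α ++ [ 𝟎 ]

  A₀ : ℕ → WordSet q
  A₀ n w = ∃[ i ] ∃[ α ] ∃[ β ]
    i ≤ ⌊ n /2⌋ × α ∈ Motzkin q i × β ∈ ElevatedMotzkin (n ∸ i) × w ≡ α ++ β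

  -- Empty when n is odd.
  A₁ : ℕ → WordSet q
  A₁ n w = ∃[ h ] ∃[ α ] ∃[ β ]
    h + h ≡ n × α ∈ ElevatedMotzkin h × β ∈ ElevatedMotzkin h × w ≡ α ++ β

  A : ℕ → WordSet q
  A n = A₀ n ∖ A₁ n

  B : ℕ → WordSet q
  B n w = ∃[ i ] ∃[ α ] ∃[ β ]
    i ≤ ⌊ n /2⌋ ∸ 1 × α ∈ Motzkin q i × β ∈ ElevatedMotzkin (n ∸ i ∸ 1) ×
    w ≡ 𝟏 ∷ α ++ β

  HasLongElevatedFactor : ℕ → WordSet q
  HasLongElevatedFactor n γ = ∃[ j ] ∃[ u ] ∃[ β ] ∃[ v ]
    ⌈ n /2⌉ ≤ j × β ∈ ElevatedMotzkin j × γ ≡ u ++ β ++ v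

  C : ℕ → WordSet q
  C n w = ∃[ γ ]
    γ ∈ Motzkin q (n ∸ 1) × ¬ HasLongElevatedFactor n γ × w ≡ γ ++ [ 𝟎 ]

  CBFS : ℕ → WordSet q
  CBFS n = A n ∪ B n ∪ C n

{-# OPTIONS --safe #-}

-- Words are read as lattice paths.  Proper prefixes of words of CBFS never go below
-- the axis.  A proper suffix of a word of A or B has height at most 0, and height 0 only
-- if it contains the final elevated factor, which is long (length at least ⌈n/2⌉);
-- a non-empty proper suffix of a word of C has negative height.  So an overlap has
-- height 0 and ends with a long elevated factor, which is impossible at the start of
-- a word of B (positive height), of C (no such factor), or of A (that would be A₁).
--
-- For non-expandability, a bifix-free word w outside CBFS is matched with a word of
-- CBFS obtained by padding a piece of w with level steps.  If w goes below the axis,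
-- w = γ 0 r with γ Motzkin; a long elevated factor of γ can be taken outermost, which
-- gives a prefix u β of w and 2…2 u β in A; otherwise 2…2 γ 0 is in C.  If w stays
-- non-negative, look at its last letter and, if this is 0, at the elevated factor β
-- that it closes: a short Motzkin suffix t gives t 2…2 0 in C, and a suffix 1 α with
-- α Motzkin gives 1 α 2…2 0 in A; in the remaining cases w itself is in A₀ or B, and
-- a word of A₁ again has a long elevated prefix.
module Submission where

open import Defs
open import Data.Empty using (⊥; ⊥-elim)
open import Data.Fin.Base using (zero; suc)
open import Data.Integer.Base as ℤ using (+_; 0ℤ; 1ℤ; -1ℤ)
import Data.Integer.Properties as ℤ
open import Data.List.Base using (List; []; _∷_; _++_; [_]; length; replicate; initLast; _∷ʳ′_)
open import Data.List.Properties
  using (++-assoc; ++-identityʳ; ++-cancelˡ; ∷-injectiveˡ; ∷-injectiveʳ; length-++; length-replicate)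
open import Data.List.Relation.Binary.Pointwise using (Pointwise-≡⇒≡; ≡⇒Pointwise-≡)
open import Data.List.Relation.Binary.Prefix.Heterogeneous using (Prefix; []; _∷_)
open import Data.List.Relation.Binary.Suffix.Heterogeneous using (Suffix; here; there)
open import Data.Nat.Base using (ℕ; zero; suc; _+_; _∸_; _≤_; _<_; s≤s; z≤n; ⌊_/2⌋; ⌈_/2⌉)
open import Data.Nat.Properties as ℕ using (_≤?_)
open import Data.Product.Base using (∃-syntax; _×_; _,_; proj₁; proj₂)
open import Data.Sum.Base using (_⊎_; inj₁; inj₂)
open import Function.Base using (_∘_)
open import Relation.Binary.PropositionalEquality hiding ([_])
open import Relation.Nullary using (¬_; Dec; yes; no)
open import Relation.Unary using (_∈_; _∉_)

-- Cutting concatenations of lists.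

++-split : ∀ {a} {X : Set a} (u : List X) {v} a {b} → u ++ v ≡ a ++ b →
  (∃[ r ] a ≡ u ++ r × v ≡ r ++ b) ⊎
  (∃[ c ] ∃[ r ] u ≡ a ++ c ∷ r × b ≡ c ∷ r ++ v)
++-split []      a       eq = inj₁ (a , refl , eq)
++-split (c ∷ u) []      eq = inj₂ (c , u , refl , sym eq)
++-split (c ∷ u) (d ∷ a) eq with ∷-injectiveˡ eq | ++-split u a (∷-injectiveʳ eq)
... | refl | inj₁ (r , p , e)     = inj₁ (r , cong (c ∷_) p , e)
... | refl | inj₂ (x , r , p , e) = inj₂ (x , r , cong (c ∷_) p , e)

length-≤-middle : ∀ {a} {X : Set a} (u v w : List X) → length v ≤ length (u ++ v ++ w)
length-≤-middle u v w = ℕ.≤-trans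
  (subst (length v ≤_) (sym (length-++ v)) (ℕ.m≤m+n _ _))
  (subst (length (v ++ w) ≤_) (sym (length-++ u)) (ℕ.m≤n+m _ _))

++-length-trim : ∀ {a} {X : Set a} (u v w : List X) → length (u ++ v ++ w) ≤ length v → u ≡ [] × w ≡ []
++-length-trim []      v []      _  = refl , refl
++-length-trim []      v (_ ∷ w) le =
  ⊥-elim (ℕ.m+1+n≰m (length v) (subst (_≤ length v) (length-++ v) le))
++-length-trim (_ ∷ u) v w       le = ⊥-elim (ℕ.<⇒≱ le (length-≤-middle u v w))

++-∷-split : ∀ {a} {X : Set a} {z d : X} u {v p} → v ++ [ z ] ≡ u ++ d ∷ p → ∃[ r ] v ≡ u ++ r
++-∷-split u {v} eq with ++-split u v (sym eq)
... | inj₁ (r , split-v , _)     = r , split-v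
... | inj₂ (_ , []    , _ , ())
... | inj₂ (_ , _ ∷ _ , _ , ())

unsnoc : ∀ {a} {X : Set a} (w : List X) → w ≡ [] ⊎ ∃[ z ] ∃[ c ] w ≡ z ++ [ c ]
unsnoc w with initLast w
... | []      = inj₁ refl
... | z ∷ʳ′ c = inj₂ (z , c , refl)

++-∷-≢[] : ∀ {a} {X : Set a} (u : List X) {c v} → u ++ c ∷ v ≢ []
++-∷-≢[] [] ()
++-∷-≢[] (_ ∷ _) ()

length-split : ∀ {a} {X : Set a} {n} {w : List X} u v →
  length w ≡ n → w ≡ u ++ v → length u + length v ≡ n
length-split u v |w|≡n eq = trans (sym (length-++ u)) (trans (cong length (sym eq)) |w|≡n)

-- Prefixes, suffixes and overlaps as concatenations.

module _ {q : ℕ} where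

  prefix⇒++ : {u w : Word q} → Prefix _≡_ u w → ∃[ p ] w ≡ u ++ p
  prefix⇒++ {w = w} []    = w , refl
  prefix⇒++ (refl ∷ pre) with p , eq ← prefix⇒++ pre = p , cong (_ ∷_) eq

  ++⇒prefix : (u p : Word q) → Prefix _≡_ u (u ++ p)
  ++⇒prefix []      p = []
  ++⇒prefix (c ∷ u) p = refl ∷ ++⇒prefix u p

  suffix⇒++ : {u w : Word q} → Suffix _≡_ u w → ∃[ s ] w ≡ s ++ u
  suffix⇒++ (here eq)   = [] , sym (Pointwise-≡⇒≡ eq)
  suffix⇒++ (there suf) with s , eq ← suffix⇒++ suf = _ ∷ s , cong (_ ∷_) eq

  ++⇒suffix : (s u : Word q) → Suffix _≡_ u (s ++ u)
  ++⇒suffix []      u = here (≡⇒Pointwise-≡ refl)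
  ++⇒suffix (c ∷ s) u = there (++⇒suffix s u)

  -- A first letter is exposed in each piece, so that non-emptiness of the common word and
  -- properness on both sides are available by pattern matching.
  Overlap : Word q → Word q → Set
  Overlap w w′ = ∃[ c ] ∃[ u ] ∃[ d ] ∃[ p ] ∃[ e ] ∃[ s ]
    w ≡ (c ∷ u) ++ d ∷ p × w′ ≡ (e ∷ s) ++ c ∷ u

  ¬overlap⇒noOverlap : {w w′ : Word q} → length w ≡ length w′ → ¬ Overlap w w′ → NoOverlap w w′
  ¬overlap⇒noOverlap _ _ [] u≢[] _ _ _ = u≢[] refl
  ¬overlap⇒noOverlap {w} {w′} len ¬o (c ∷ u) _ pre u≢w suf
    with prefix⇒++ pre | suffix⇒++ suf
  ... | []    , eq | _           = u≢w (sym (trans eq (++-identityʳ _)))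
  ... | d ∷ p , eq | e ∷ s , eq′ = ¬o (c , u , d , p , e , s , eq , eq′)
  -- `NoOverlap` also allows the suffix to be all of `w′`; a proper prefix of `w` is too short for
  -- that, as the lengths agree.
  ... | d ∷ p , eq | []    , eq′ =
    ℕ.m≢1+m+n (length (c ∷ u))
      (trans (sym (length-split (c ∷ u) (d ∷ p) (trans len (cong length eq′)) eq))
        (ℕ.+-suc (length (c ∷ u)) (length p)))

  mkOverlap : ∀ {w w′} t {p s : Word q} → t ≢ [] → p ≢ [] → s ≢ [] →
    w ≡ t ++ p → w′ ≡ s ++ t → Overlap w w′
  mkOverlap []                        t≢[] _    _    _  _   = ⊥-elim (t≢[] refl)
  mkOverlap (_ ∷ _) {[]}              _    p≢[] _    _  _   = ⊥-elim (p≢[] refl)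
  mkOverlap (_ ∷ _) {_ ∷ _} {[]}      _    _    s≢[] _  _   = ⊥-elim (s≢[] refl)
  mkOverlap (_ ∷ _) {_ ∷ _} {_ ∷ _}   _    _    _    eq eq′ = _ , _ , _ , _ , _ , _ , eq , eq′

  noOverlap⇒¬overlap : {w w′ : Word q} → NoOverlap w w′ → ¬ Overlap w w′
  noOverlap⇒¬overlap no-o (c , u , d , p , e , s , refl , refl) =
    no-o (c ∷ u) (λ ()) (++⇒prefix (c ∷ u) (d ∷ p)) proper (++⇒suffix (e ∷ s) (c ∷ u))
    where
    proper : c ∷ u ≢ (c ∷ u) ++ d ∷ p
    proper eq with () ← ++-cancelˡ (c ∷ u) _ _ (trans (++-identityʳ (c ∷ u)) eq)

-- Non-negative lattice paths.

module Paths (q : ℕ) where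

  W : Set
  W = Word (3 + q)

  pattern 𝟘   = zero
  pattern 𝟙   = suc zero
  pattern ℓ c = suc (suc c)

  -- Path h w k: started at height h, the path of w stays non-negative and ends at height k.
  data Path : ℕ → W → ℕ → Set where
    []    : ∀ {h} → Path h [] h
    fall  : ∀ {h w k} → Path h w k → Path (suc h) (𝟘 ∷ w) k
    rise  : ∀ {h w k} → Path (suc h) w k → Path h (𝟙 ∷ w) k
    level : ∀ {h c w k} → Path h w k → Path h (ℓ c ∷ w) k

  infixr 5 _⁀_

  _⁀_ : ∀ {h u m v k} → Path h u m → Path m v k → Path h (u ++ v) k
  []      ⁀ r = r
  fall p  ⁀ r = fall (p ⁀ r)
  rise p  ⁀ r = rise (p ⁀ r)
  level p ⁀ r = level (p ⁀ r)

  split : ∀ {h k v} u → Path h (u ++ v) k → ∃[ m ] Path h u m × Path m v k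
  split []      p         = _ , [] , p
  split (_ ∷ u) (fall p)  with m , a , b ← split u p = m , fall a , b
  split (_ ∷ u) (rise p)  with m , a , b ← split u p = m , rise a , b
  split (_ ∷ u) (level p) with m , a , b ← split u p = m , level a , b

  raise : ∀ {h w k} → Path h w k → Path (suc h) w (suc k)
  raise []        = []
  raise (fall p)  = fall (raise p)
  raise (rise p)  = rise (raise p)
  raise (level p) = level (raise p)

  raise-by : ∀ {h w k} m → Path h w k → Path (m + h) w (m + k)
  raise-by zero    p = p
  raise-by (suc m) p = raise (raise-by m p)

  loop : ∀ {w} h → Path 0 w 0 → Path h w h
  loop {w} h p = subst (λ m → Path m w m) (ℕ.+-identityʳ h) (raise-by h p)

  end-unique : ∀ {h w k k′} → Path h w k → Path h w k′ → k ≡ k′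
  end-unique []        []         = refl
  end-unique (fall p)  (fall p′)  = end-unique p p′
  end-unique (rise p)  (rise p′)  = end-unique p p′
  end-unique (level p) (level p′) = end-unique p p′

  -- The first path shows that the height of w is a, the second that it is -b.
  path-to-zero : ∀ {a b w} → Path 0 w a → Path b w 0 → b + a ≡ 0
  path-to-zero {a} {b} {w} p r =
    end-unique (subst (λ h → Path h w (b + a)) (ℕ.+-identityʳ b) (raise-by b p)) r

  -- The second case cuts at the first fall below the axis; the part before that fall must end
  -- exactly on the axis.
  first-descent : ∀ h w →
    (∃[ k ] Path h w k) ⊎ (∃[ γ ] ∃[ r ] w ≡ γ ++ 𝟘 ∷ r × Path h γ 0)
  first-descent h [] = inj₁ (h , [])
  first-descent zero (𝟘 ∷ w) = inj₂ ([] , w , refl , [])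
  first-descent (suc h) (𝟘 ∷ w) with first-descent h w
  ... | inj₁ (k , p)          = inj₁ (k , fall p)
  ... | inj₂ (γ , r , eq , p) = inj₂ (𝟘 ∷ γ , r , cong (𝟘 ∷_) eq , fall p)
  first-descent h (𝟙 ∷ w) with first-descent (suc h) w
  ... | inj₁ (k , p)          = inj₁ (k , rise p)
  ... | inj₂ (γ , r , eq , p) = inj₂ (𝟙 ∷ γ , r , cong (𝟙 ∷_) eq , rise p)
  first-descent h (ℓ c ∷ w) with first-descent h w
  ... | inj₁ (k , p)          = inj₁ (k , level p)
  ... | inj₂ (γ , r , eq , p) = inj₂ (ℓ c ∷ γ , r , cong (ℓ c ∷_) eq , level p)

  -- Mirror image of `first-descent`, scanning from the right: either no suffix has positive height,
  -- or the shortest one that does is an unmatched rise followed by a Motzkin word.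
  last-ascent : ∀ w →
    (∃[ m ] Path m w 0) ⊎ (∃[ x ] ∃[ α ] w ≡ x ++ 𝟙 ∷ α × Path 0 α 0)
  last-ascent [] = inj₁ (0 , [])
  last-ascent (c ∷ w) with last-ascent w
  last-ascent (c ∷ w)   | inj₂ (x , α , eq , p) = inj₂ (c ∷ x , α , cong (c ∷_) eq , p)
  last-ascent (𝟘 ∷ w)   | inj₁ (m , p)          = inj₁ (suc m , fall p)
  last-ascent (ℓ c ∷ w) | inj₁ (m , p)          = inj₁ (m , level p)
  last-ascent (𝟙 ∷ w)   | inj₁ (zero , p)       = inj₂ ([] , w , refl , p)
  last-ascent (𝟙 ∷ w)   | inj₁ (suc m , p)      = inj₁ (m , rise p)

  -- Elevated words and elevated factors.

  elevate : W → W
  elevate α = 𝟙 ∷ α ++ [ 𝟘 ]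

  elevate-++ : ∀ α r → elevate α ++ r ≡ 𝟙 ∷ α ++ 𝟘 ∷ r
  elevate-++ α r = cong (𝟙 ∷_) (++-assoc α [ 𝟘 ] r)

  elevate-path : ∀ {α} → Path 0 α 0 → Path 0 (elevate α) 0
  elevate-path p = rise (raise p ⁀ fall [])

  length-elevate : ∀ α → length (elevate α) ≡ 2 + length α
  length-elevate α = cong suc (trans (length-++ α) (ℕ.+-comm (length α) 1))

  -- The initial rise lifts all of `α` by one, and only the last letter, which a proper prefix
  -- misses, undoes it.
  elevate-proper-prefix : ∀ {α c d} s {t} → Path 0 α 0 → elevate α ≡ (c ∷ s) ++ d ∷ t →
    ∃[ j ] Path 0 (c ∷ s) (suc j)
  elevate-proper-prefix s p eq with ∷-injectiveˡ eq | ++-∷-split s (∷-injectiveʳ eq)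
  ... | refl | r , refl with j , a , _ ← split s p = j , rise (raise a)

  -- A cut strictly inside the elevated factor would be at positive height, by
  -- `elevate-proper-prefix`.
  return-before-elevated : ∀ {α β d t} s → Path 0 α 0 → Path 0 β 0 →
    α ++ elevate β ≡ s ++ d ∷ t → Path 0 s 0 →
    ∃[ r ] α ≡ s ++ r × d ∷ t ≡ r ++ elevate β
  return-before-elevated {α} s pα pβ eq ps with ++-split s α (sym eq)
  ... | inj₁ split-α = split-α
  ... | inj₂ (c , r , refl , eq′) with j , pr ← elevate-proper-prefix r pβ eq′
      with () ← end-unique ps (pα ⁀ pr)

  -- Induction on the height `j` at which the factor starts: the last unmatched rise of `u` and the
  -- first fall of `v` below its starting level enclose a longer elevated factor, which starts one
  -- level lower.
  outermost : ∀ j {u β v} → Path 0 u j → Path 0 β 0 → Path j v 0 →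
    ∃[ u′ ] ∃[ β′ ] ∃[ v′ ] Path 0 u′ 0 × Path 0 β′ 0 ×
      u ++ elevate β ++ v ≡ u′ ++ elevate β′ ++ v′ ×
      length (elevate β) ≤ length (elevate β′)
  outermost zero pu pβ pv = _ , _ , _ , pu , pβ , refl , ℕ.≤-refl
  outermost (suc i) {u} {β} {v} pu pβ pv with last-ascent u | first-descent 0 v
  ... | inj₁ (m , p) | _ with () ← trans (sym (ℕ.+-suc m i)) (path-to-zero pu p)
  ... | inj₂ _ | inj₁ (k , p) with () ← path-to-zero p pv
  ... | inj₂ (x , α , refl , pα) | inj₂ (γ , r , refl , pγ)
      with _ , px , p𝟙α ← split x pu
      with refl ← end-unique p𝟙α (rise (loop _ pα))
      with _ , pγ′ , p𝟘r ← split γ pv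
      with refl ← end-unique pγ′ (loop (suc i) pγ)
      with fall pr ← p𝟘r
      with u′ , β′ , v′ , pu′ , pβ′ , eq , le ← outermost i px (pα ⁀ elevate-path pβ ⁀ pγ) pr
      = u′ , β′ , v′ , pu′ , pβ′ , trans regroup eq , ℕ.≤-trans longer le
    where
    regroup : (x ++ 𝟙 ∷ α) ++ elevate β ++ γ ++ 𝟘 ∷ r ≡ x ++ elevate (α ++ elevate β ++ γ) ++ r
    regroup = trans (++-assoc x (𝟙 ∷ α) _) (cong (x ++_) (sym
      (trans (elevate-++ (α ++ elevate β ++ γ) r)
        (cong (𝟙 ∷_) (trans (++-assoc α (elevate β ++ γ) _)
          (cong (α ++_) (++-assoc (elevate β) γ _)))))))

    longer : length (elevate β) ≤ length (elevate (α ++ elevate β ++ γ))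
    longer = ℕ.≤-trans (length-≤-middle α (elevate β) γ)
      (subst (length (α ++ elevate β ++ γ) ≤_) (sym (length-elevate (α ++ elevate β ++ γ))) (ℕ.m≤n+m _ 2))

  -- Paths compared with integer heights and Motzkin words.

  path⇒height : ∀ {h w k} → Path h w k → + h ℤ.+ height w ≡ + k
  path⇒height {h} [] = ℤ.+-identityʳ (+ h)
  path⇒height {suc h} {_ ∷ w} (fall p) =
    trans (sym (ℤ.+-assoc (+ suc h) -1ℤ (height w))) (path⇒height p)
  path⇒height {h} {_ ∷ w} (rise p) =
    trans (sym (ℤ.+-assoc (+ h) 1ℤ (height w)))
      (trans (cong (λ m → + m ℤ.+ height w) (ℕ.+-comm h 1)) (path⇒height p))
  path⇒height {h} {_ ∷ w} (level p) =
    trans (cong (λ z → + h ℤ.+ z) (ℤ.+-identityˡ (height w))) (path⇒height p)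

  nonNegative⇒path : ∀ h w → (∀ u → Prefix _≡_ u w → 0ℤ ℤ.≤ + h ℤ.+ height u) → ∃[ k ] Path h w k
  nonNegative⇒path h [] _ = h , []
  nonNegative⇒path zero (𝟘 ∷ w) nn with () ← nn [ 𝟘 ] (refl ∷ [])
  nonNegative⇒path (suc h) (𝟘 ∷ w) nn
    with k , p ← nonNegative⇒path h w (λ u pre →
      subst (0ℤ ℤ.≤_) (sym (ℤ.+-assoc (+ suc h) -1ℤ (height u))) (nn (𝟘 ∷ u) (refl ∷ pre)))
    = k , fall p
  nonNegative⇒path h (𝟙 ∷ w) nn
    with k , p ← nonNegative⇒path (suc h) w (λ u pre →
      subst (0ℤ ℤ.≤_)
        (trans (sym (ℤ.+-assoc (+ h) 1ℤ (height u)))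
          (cong (λ m → + m ℤ.+ height u) (ℕ.+-comm h 1)))
        (nn (𝟙 ∷ u) (refl ∷ pre)))
    = k , rise p
  nonNegative⇒path h (ℓ c ∷ w) nn
    with k , p ← nonNegative⇒path h w (λ u pre →
      subst (λ z → 0ℤ ℤ.≤ + h ℤ.+ z) (ℤ.+-identityˡ (height u)) (nn (ℓ c ∷ u) (refl ∷ pre)))
    = k , level p

  motzkin⇒path : ∀ {m w} → Motzkin (3 + q) m w → Path 0 w 0
  motzkin⇒path {w = w} (_ , h≡0 , nn)
    with k , p ← nonNegative⇒path 0 w (λ u pre → subst (0ℤ ℤ.≤_) (sym (ℤ.+-identityˡ _)) (nn u pre))
    = subst (Path 0 w) (ℤ.+-injective (trans (sym (path⇒height p)) (cong (λ z → 0ℤ ℤ.+ z) h≡0))) p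

  path⇒motzkin : ∀ {m w} → length w ≡ m → Path 0 w 0 → Motzkin (3 + q) m w
  path⇒motzkin |w|≡m p = |w|≡m , trans (sym (ℤ.+-identityˡ _)) (path⇒height p) , nonNeg
    where
    nonNeg : ∀ u → Prefix _≡_ u _ → 0ℤ ℤ.≤ height u
    nonNeg u pre with v , refl ← prefix⇒++ pre with k , pu , _ ← split u p =
      subst (0ℤ ℤ.≤_) (trans (sym (path⇒height pu)) (ℤ.+-identityˡ _)) (ℤ.+≤+ z≤n)

-- The sets A, B and C described by paths and long elevated factors.

module Sets (q n : ℕ) (3≤n : 3 ≤ n) where

  open Paths q
  open Construction (3 + q) (s≤s (s≤s (s≤s z≤n)))

  Long : W → Set
  Long w = ⌈ n /2⌉ ≤ length w

  halves : ⌊ n /2⌋ + ⌈ n /2⌉ ≡ n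
  halves = ℕ.⌊n/2⌋+⌈n/2⌉≡n n

  ∸⌊n/2⌋ : n ∸ ⌊ n /2⌋ ≡ ⌈ n /2⌉
  ∸⌊n/2⌋ = trans (cong (_∸ ⌊ n /2⌋) (sym halves)) (ℕ.m+n∸m≡n ⌊ n /2⌋ ⌈ n /2⌉)

  complement-long : ∀ {i} → i ≤ ⌊ n /2⌋ → ⌈ n /2⌉ ≤ n ∸ i
  complement-long {i} i≤ = subst (_≤ n ∸ i) ∸⌊n/2⌋ (ℕ.∸-monoʳ-≤ n i≤)

  complement-short : ∀ {i j} → i + j ≡ n → ⌈ n /2⌉ ≤ j → i ≤ ⌊ n /2⌋
  complement-short {i} i+j≡n long = ℕ.+-cancelʳ-≤ ⌈ n /2⌉ i ⌊ n /2⌋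
    (subst (i + ⌈ n /2⌉ ≤_) (trans i+j≡n (sym halves)) (ℕ.+-monoʳ-≤ i long))

  elevated⇒elevate : ∀ {m w} → ElevatedMotzkin m w →
    ∃[ β ] Path 0 β 0 × w ≡ elevate β × length w ≡ m
  elevated⇒elevate (2≤m , β , mot , refl) =
    β , motzkin⇒path mot , refl ,
    trans (length-elevate β) (trans (cong (λ k → 2 + k) (proj₁ mot)) (ℕ.m+[n∸m]≡n 2≤m))

  elevate⇒elevated : ∀ {m β} → Path 0 β 0 → length (elevate β) ≡ m → ElevatedMotzkin m (elevate β)
  elevate⇒elevated {m} {β} p refl =
    subst (2 ≤_) (sym (length-elevate β)) (s≤s (s≤s z≤n)) ,
    β , path⇒motzkin (sym (cong (_∸ 2) (length-elevate β))) p , refl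

  A₀⇒ : ∀ {w} → w ∈ A₀ n → length w ≡ n ×
    ∃[ α ] ∃[ β ] Path 0 α 0 × Path 0 β 0 × Long (elevate β) × w ≡ α ++ elevate β
  A₀⇒ (i , α , _ , i≤ , mot , el , refl) with β , pβ , refl , len ← elevated⇒elevate el =
    trans (length-++ α) (trans (cong₂ _+_ (proj₁ mot) len)
      (ℕ.m+[n∸m]≡n (ℕ.≤-trans i≤ (ℕ.⌊n/2⌋≤n n)))) ,
    α , β , motzkin⇒path mot , pβ , subst (⌈ n /2⌉ ≤_) (sym len) (complement-long i≤) , refl

  ⇒A₀ : ∀ {w} α {β} → length w ≡ n → Path 0 α 0 → Path 0 β 0 → Long (elevate β) →
    w ≡ α ++ elevate β → w ∈ A₀ n
  ⇒A₀ α {β} |w|≡n pα pβ long eq =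
    length α , α , elevate β , complement-short lengths long , path⇒motzkin refl pα ,
    elevate⇒elevated pβ (trans (sym (ℕ.m+n∸m≡n (length α) _)) (cong (_∸ length α) lengths)) , eq
    where
    lengths : length α + length (elevate β) ≡ n
    lengths = length-split α (elevate β) |w|≡n eq

  A₁⇒ : ∀ {w} → w ∈ A₁ n → ∃[ α ] ∃[ β ] Path 0 α 0 × Path 0 β 0 ×
    Long (elevate α) × w ≡ elevate α ++ elevate β
  A₁⇒ (h , _ , _ , refl , el , el′ , refl)
    with α , pα , refl , len ← elevated⇒elevate el | β , pβ , refl , _ ← elevated⇒elevate el′ =
    α , β , pα , pβ ,
    ℕ.≤-reflexive (trans (sym (ℕ.n≡⌈n+n/2⌉ h)) (sym len)) , refl

  -- Two long factors that fill the word are squeezed between `⌈ n /2⌉` and `⌊ n /2⌋`, so both have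
  -- length exactly half of `n`.
  ⇒A₁ : ∀ {w α β} → length w ≡ n → Path 0 α 0 → Path 0 β 0 →
    Long (elevate α) → Long (elevate β) → w ≡ elevate α ++ elevate β → w ∈ A₁ n
  ⇒A₁ {α = α} {β} |w|≡n pα pβ long long′ eq =
    h , elevate α , elevate β , h+h≡n , elevate⇒elevated pα refl ,
    elevate⇒elevated pβ (ℕ.+-cancelˡ-≡ h _ _ (trans lengths (sym h+h≡n))) , eq
    where
    h : ℕ
    h = length (elevate α)

    lengths : h + length (elevate β) ≡ n
    lengths = length-split (elevate α) (elevate β) |w|≡n eq

    h≤⌊n/2⌋ : h ≤ ⌊ n /2⌋
    h≤⌊n/2⌋ = complement-short lengths long′

    h+h≡n : h + h ≡ n
    h+h≡n = trans
      (cong₂ _+_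
        (ℕ.≤-antisym h≤⌊n/2⌋ (ℕ.≤-trans (ℕ.⌊n/2⌋≤⌈n/2⌉ n) long))
        (ℕ.≤-antisym (ℕ.≤-trans h≤⌊n/2⌋ (ℕ.⌊n/2⌋≤⌈n/2⌉ n)) long))
      halves

  B⇒ : ∀ {w} → w ∈ B n → length w ≡ n ×
    ∃[ α ] ∃[ β ] Path 0 α 0 × Path 0 β 0 × Long (elevate β) × w ≡ 𝟙 ∷ α ++ elevate β
  B⇒ (i , α , _ , i≤ , mot , el , refl) with β , pβ , refl , len ← elevated⇒elevate el =
    trans (cong suc (length-++ α)) (trans (cong₂ (λ a b → suc (a + b)) (proj₁ mot) len′)
      (ℕ.m+[n∸m]≡n (ℕ.≤-trans i<⌊n/2⌋ (ℕ.⌊n/2⌋≤n n)))) ,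
    α , β , motzkin⇒path mot , pβ ,
    subst (⌈ n /2⌉ ≤_) (sym len′) (complement-long i<⌊n/2⌋) , refl
    where
    i<⌊n/2⌋ : suc i ≤ ⌊ n /2⌋
    -- The subtraction in `⌊ n /2⌋ ∸ 1` is not truncated, because `2 ≤ n`.
    i<⌊n/2⌋ = subst (suc i ≤_) (ℕ.m+[n∸m]≡n (ℕ.⌊n/2⌋-mono (ℕ.≤-trans (ℕ.n≤1+n 2) 3≤n))) (s≤s i≤)

    len′ : length (elevate β) ≡ n ∸ suc i
    len′ = trans len (trans (ℕ.∸-+-assoc n i 1) (cong (n ∸_) (ℕ.+-comm i 1)))

  ⇒B : ∀ {w} α {β} → length w ≡ n → Path 0 α 0 → Path 0 β 0 → Long (elevate β) →
    w ≡ 𝟙 ∷ α ++ elevate β → w ∈ B n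
  ⇒B α {β} |w|≡n pα pβ long eq =
    length α , α , elevate β , ℕ.∸-monoˡ-≤ {suc (length α)} 1 (complement-short lengths long) ,
    path⇒motzkin refl pα , elevate⇒elevated pβ len , eq
    where
    lengths : suc (length α) + length (elevate β) ≡ n
    lengths = length-split (𝟙 ∷ α) (elevate β) |w|≡n eq

    len : length (elevate β) ≡ n ∸ length α ∸ 1
    len = sym (trans (ℕ.∸-+-assoc n (length α) 1)
      (trans (cong₂ _∸_ (sym lengths) (ℕ.+-comm (length α) 1)) (ℕ.m+n∸m≡n (suc (length α)) _)))

  LongFactor : W → Set
  LongFactor γ = ∃[ u ] ∃[ β ] ∃[ v ] Path 0 β 0 × Long (elevate β) × γ ≡ u ++ elevate β ++ v

  hasLong⇒longFactor : ∀ {γ} → HasLongElevatedFactor n γ → LongFactor γ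
  hasLong⇒longFactor (_ , u , _ , v , j≥ , el , eq) with β , pβ , refl , refl ← elevated⇒elevate el =
    u , β , v , pβ , j≥ , eq

  longFactor⇒hasLong : ∀ {γ} → LongFactor γ → HasLongElevatedFactor n γ
  longFactor⇒hasLong (u , β , v , pβ , long , eq) =
    _ , u , elevate β , v , long , elevate⇒elevated pβ refl , eq

  C⇒ : ∀ {w} → w ∈ C n → length w ≡ n ×
    ∃[ γ ] Path 0 γ 0 × ¬ LongFactor γ × w ≡ γ ++ [ 𝟘 ]
  C⇒ (γ , mot , ¬long , refl) =
    trans (length-++ γ) (trans (cong (_+ 1) (proj₁ mot)) (ℕ.m∸n+n≡m (ℕ.≤-trans (s≤s z≤n) 3≤n))) ,
    γ , motzkin⇒path mot , ¬long ∘ longFactor⇒hasLong , refl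

  ⇒C : ∀ {w} γ → length w ≡ n → Path 0 γ 0 → ¬ LongFactor γ → w ≡ γ ++ [ 𝟘 ] → w ∈ C n
  ⇒C γ |w|≡n p ¬long eq =
    γ , path⇒motzkin len p , ¬long ∘ hasLong⇒longFactor , eq
    where
    len : length γ ≡ n ∸ 1
    len = trans (sym (ℕ.m+n∸n≡m (length γ) 1)) (cong (_∸ 1) (length-split γ [ 𝟘 ] |w|≡n eq))

  -- Cross-bifix-freeness.

  CBFS-length : ∀ {w} → w ∈ CBFS n → length w ≡ n
  CBFS-length (inj₁ (a , _))  = proj₁ (A₀⇒ a)
  CBFS-length (inj₂ (inj₁ b)) = proj₁ (B⇒ b)
  CBFS-length (inj₂ (inj₂ c)) = proj₁ (C⇒ c)

  CBFS-prefix : ∀ {w d p} u → w ∈ CBFS n → w ≡ u ++ d ∷ p → ∃[ a ] Path 0 u a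
  CBFS-prefix u (inj₁ (a , _)) eq with _ , _ , _ , pα , pβ , _ , refl ← A₀⇒ a
    with k , pu , _ ← split u (subst (λ w → Path 0 w 0) eq (pα ⁀ elevate-path pβ)) = k , pu
  CBFS-prefix u (inj₂ (inj₁ b)) eq with _ , _ , _ , pα , pβ , _ , refl ← B⇒ b
    with k , pu , _ ← split u (subst (λ w → Path 0 w 1) eq (rise (loop 1 (pα ⁀ elevate-path pβ)))) = k , pu
  CBFS-prefix u (inj₂ (inj₂ c)) eq with _ , _ , pγ , _ , refl ← C⇒ c
    with r , refl ← ++-∷-split u eq with k , pu , _ ← split u pγ = k , pu

  C-suffix : ∀ {w c u e a} s → w ∈ C n → w ≡ (e ∷ s) ++ c ∷ u → ¬ Path 0 (c ∷ u) a
  C-suffix {c = c} {u} {e} s w∈C eq pu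
    with _ , _ , pγ , _ , refl ← C⇒ w∈C
    with r , refl ← ++-∷-split (e ∷ s) eq
    with _ , ps , _ ← split (e ∷ s) pγ
    -- Started at height 1, the whole word stays non-negative and ends at 0. The cut is then at
    -- height at least 1, so the suffix has negative height.
    with _ , ps′ , pu′ ← split (e ∷ s) (subst (λ w → Path 1 w 0) eq (raise pγ ⁀ fall []))
    with refl ← end-unique ps′ (raise ps)
    with () ← path-to-zero pu pu′

  -- The shape forced on the common word of any overlap between words of `CBFS n`.
  EndsLong : W → Set
  EndsLong w = Path 0 w 0 × ∃[ r ] ∃[ β ] Path 0 β 0 × Long (elevate β) × w ≡ r ++ elevate β

  -- The whole word has height 0, and neither the prefix `s` nor the suffix has negative height, so
  -- both have height 0; the cut then lies before the elevated factor.
  long-suffix : ∀ {α β c u a} s → Path 0 α 0 → Path 0 β 0 → Long (elevate β) →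
    α ++ elevate β ≡ s ++ c ∷ u → Path 0 (c ∷ u) a → EndsLong (c ∷ u)
  long-suffix {β = β} {c} {u} {a} s pα pβ long eq pu
    with m , ps , pu′ ← split s (subst (λ w → Path 0 w 0) eq (pα ⁀ elevate-path pβ))
    with refl ← ℕ.m+n≡0⇒m≡0 m (path-to-zero pu pu′)
    with r , _ , eq′ ← return-before-elevated s pα pβ eq ps
    = pu′ , r , β , pβ , long , eq′

  CBFS-suffix : ∀ {w c u e s a} → w ∈ CBFS n → w ≡ (e ∷ s) ++ c ∷ u → Path 0 (c ∷ u) a →
    EndsLong (c ∷ u)
  CBFS-suffix {e = e} {s} (inj₁ (a , _)) eq pu with _ , _ , _ , pα , pβ , long , refl ← A₀⇒ a =
    long-suffix (e ∷ s) pα pβ long eq pu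
  -- Removing the initial rise leaves a word of the same shape as in A₀; here the remaining cut `s`
  -- may be empty.
  CBFS-suffix {s = s} (inj₂ (inj₁ b)) eq pu with _ , _ , _ , pα , pβ , long , refl ← B⇒ b =
    long-suffix s pα pβ long (∷-injectiveʳ eq) pu
  CBFS-suffix {s = s} (inj₂ (inj₂ c)) eq pu = ⊥-elim (C-suffix s c eq pu)

  A₀-long-prefix : ∀ {w d p} u → w ∈ A₀ n → w ≡ u ++ d ∷ p → EndsLong u → w ∈ A₁ n
  A₀-long-prefix {d = d} {p} _ a eq (pu , r , β′ , pβ′ , long′ , refl)
    with |w|≡n , α , β , pα , pβ , long , refl ← A₀⇒ a
    with r′ , eqα , _ ← return-before-elevated (r ++ elevate β′) pα pβ eq pu
    with refl ← trans eqα (++-assoc r (elevate β′) r′)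
    with lengths ← length-split (r ++ elevate β′ ++ r′) (elevate β) |w|≡n refl
    with |α|≤⌊n/2⌋ ← complement-short lengths long
    -- The prefix lies inside `α`, whose length is at most `⌊ n /2⌋`, so its long elevated factor is
    -- all of `α`.
    with refl , refl ← ++-length-trim r (elevate β′) r′
      (ℕ.≤-trans |α|≤⌊n/2⌋ (ℕ.≤-trans (ℕ.⌊n/2⌋≤⌈n/2⌉ n) long′))
    = ⇒A₁ |w|≡n pβ′ pβ long′ long (cong (_++ elevate β) (++-identityʳ (elevate β′)))

  CBFS-¬overlap : ∀ {w w′} → w ∈ CBFS n → w′ ∈ CBFS n → ¬ Overlap w w′
  CBFS-¬overlap w∈ w′∈ (c , u , d , p , e , s , eq , eq′)
    with _ , pu ← CBFS-prefix (c ∷ u) w∈ eq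
    with ends ← CBFS-suffix w′∈ eq′ pu
    with w∈
  ... | inj₁ (a , ¬a₁) = ¬a₁ (A₀-long-prefix (c ∷ u) a eq ends)
  ... | inj₂ (inj₁ b)
      with _ , _ , _ , pα , pβ , _ , refl ← B⇒ b
      with refl ← ∷-injectiveˡ eq
      with _ , pu′ , _ ← split u (subst (λ w → Path 0 w 0) (∷-injectiveʳ eq) (pα ⁀ elevate-path pβ))
      -- The initial rise of a word of B is never matched, so a non-empty prefix has positive
      -- height, against the height 0 of the overlap.
      with () ← end-unique (rise (raise pu′)) (proj₁ ends)
  ... | inj₂ (inj₂ c∈C)
      with _ , _ , _ , ¬long , refl ← C⇒ c∈C
      with r′ , refl ← ++-∷-split (c ∷ u) eq
      with _ , r , β , pβ , long , eqβ ← ends =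
    ¬long (r , β , r′ , pβ , long , trans (cong (_++ r′) eqβ) (++-assoc r (elevate β) r′))

  CBFS-crossBifixFree : IsCrossBifixFreeSet (3 + q) n (CBFS n)
  CBFS-crossBifixFree =
    (λ w∈ → CBFS-length w∈ , noOverlap w∈ w∈) ,
    λ w w′ w∈ w′∈ _ → noOverlap w∈ w′∈ , noOverlap w′∈ w∈
    where
    noOverlap : ∀ {w w′} → w ∈ CBFS n → w′ ∈ CBFS n → NoOverlap w w′
    noOverlap w∈ w′∈ =
      ¬overlap⇒noOverlap (trans (CBFS-length w∈) (sym (CBFS-length w′∈))) (CBFS-¬overlap w∈ w′∈)

  -- Padding with the level letter 2, which exists in every alphabet of at least three letters.

  flat : ℕ → W
  flat m = replicate m (ℓ zero)

  flat-path : ∀ m → Path 0 (flat m) 0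
  flat-path zero    = []
  flat-path (suc m) = level (flat-path m)

  flat-letter : ∀ m a {z b} → flat m ≡ a ++ z ∷ b → z ≡ ℓ zero
  flat-letter (suc m) []      eq = sym (∷-injectiveˡ eq)
  flat-letter (suc m) (_ ∷ a) eq = flat-letter m a (∷-injectiveʳ eq)

  -- An elevated factor starts with a rise, so it cannot start inside the padding.
  longFactor-flat-++ : ∀ m {γ} → LongFactor (flat m ++ γ) → LongFactor γ
  longFactor-flat-++ m (u , β , v , pβ , long , eq) with ++-split (flat m) u eq
  ... | inj₁ (r , _ , eq′) = r , β , v , pβ , long , eq′
  ... | inj₂ (c , r , eq₁ , eq₂)
      with refl ← ∷-injectiveˡ eq₂ with () ← flat-letter m u eq₁

  -- An elevated factor ends with a fall, so it cannot reach into the final level steps.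
  short-++-flat : ∀ t m → length t < ⌈ n /2⌉ → ¬ LongFactor (t ++ flat m)
  short-++-flat t m short (u , β , v , pβ , long , eq)
    with ++-split t (u ++ 𝟙 ∷ β)
      (trans eq (trans (cong (u ++_) (elevate-++ β v)) (sym (++-assoc u (𝟙 ∷ β) (𝟘 ∷ v)))))
  ... | inj₁ (r , _ , eq′) with () ← flat-letter m r eq′
  ... | inj₂ (_ , r , refl , eq′) with refl ← ∷-injectiveˡ eq′ =
    ℕ.<⇒≱ short (ℕ.≤-trans long (subst (length (elevate β) ≤_) (cong length regroup)
      (length-≤-middle u (elevate β) r)))
    where
    regroup : u ++ elevate β ++ r ≡ (u ++ 𝟙 ∷ β) ++ 𝟘 ∷ r
    regroup = trans (cong (u ++_) (elevate-++ β r)) (sym (++-assoc u (𝟙 ∷ β) (𝟘 ∷ r)))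

  length-flat-++ : ∀ {w} t {p} → length w ≡ n → w ≡ t ++ p → length (flat (length p) ++ t) ≡ n
  length-flat-++ t {p} |w|≡n eq = trans (length-++ (flat (length p)))
    (trans (cong (_+ length t) (length-replicate (length p)))
      (trans (ℕ.+-comm (length p) (length t)) (length-split t p |w|≡n eq)))

  length-++-flat-∷ʳ : ∀ t m → length ((t ++ flat m) ++ [ 𝟘 ]) ≡ suc (length t + m)
  length-++-flat-∷ʳ t m = trans (length-++ (t ++ flat m))
    (trans (ℕ.+-comm _ 1) (cong suc
      (trans (length-++ t) (cong (λ l → length t + l) (length-replicate m)))))

  flat≢[] : ∀ {p : W} → p ≢ [] → flat (length p) ≢ []
  flat≢[] {[]}    p≢[] _ = p≢[] refl
  flat≢[] {_ ∷ _} _    ()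

  -- Non-expandability: a compatible word outside the set is contradictory.

  module Expansion {w : W} (|w|≡n : length w ≡ n) (w∉ : w ∉ CBFS n)
    (compatible : ∀ {s} → s ∈ CBFS n → CrossBifixFree w s) where

    ¬overlapʳ : ∀ {s} → s ∈ CBFS n → ¬ Overlap w s
    ¬overlapʳ s∈ = noOverlap⇒¬overlap (proj₁ (compatible s∈))

    ¬overlapˡ : ∀ {s} → s ∈ CBFS n → ¬ Overlap s w
    ¬overlapˡ s∈ = noOverlap⇒¬overlap (proj₂ (compatible s∈))

    ¬long-prefix : ∀ u {β p} → Path 0 u 0 → Path 0 β 0 → Long (elevate β) →
      p ≢ [] → w ≢ (u ++ elevate β) ++ p
    ¬long-prefix _ {p = []} _ _ _ p≢[] _ = p≢[] refl
    ¬long-prefix u {β} {d ∷ p} pu pβ long p≢[] eq =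
      ¬overlapʳ (inj₁ (⇒A₀ (flat k ++ u)
          (length-flat-++ (u ++ elevate β) {d ∷ p} |w|≡n eq) (flat-path k ⁀ pu) pβ long
          (sym (++-assoc (flat k) u (elevate β))) , ¬A₁))
        (mkOverlap (u ++ elevate β) (++-∷-≢[] u) p≢[] (flat≢[] p≢[]) eq refl)
      where
      k : ℕ
      k = length (d ∷ p)

      ¬A₁ : flat k ++ u ++ elevate β ∉ A₁ n
      -- The padding is non-empty, so the word starts with a level step, whereas words of A₁ start
      -- with a rise.
      ¬A₁ a₁ with A₁⇒ a₁
      ... | _ , _ , _ , _ , _ , ()

    ¬long-factor-prefix : ∀ {γ p} → Path 0 γ 0 → p ≢ [] → w ≡ γ ++ p → ¬ LongFactor γ
    ¬long-factor-prefix {p = p} pγ p≢[] eq (u , β , v , pβ , long , refl)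
      with j , pu , pβv ← split u pγ
      with _ , pβ′ , pv ← split (elevate β) pβv
      -- The elevated factor returns to its starting level `j`, so `v` leads from `j` to 0, as
      -- `outermost` requires.
      with refl ← end-unique pβ′ (loop j (elevate-path pβ))
      with u′ , β′ , v′ , pu′ , pβ″ , eq′ , longer ← outermost j pu pβ pv =
      ¬long-prefix u′ pu′ pβ″ (ℕ.≤-trans long longer) (nonEmpty v′)
        (trans eq (trans (cong (_++ p) eq′) (trans (++-assoc u′ (elevate β′ ++ v′) p)
          (trans (cong (u′ ++_) (++-assoc (elevate β′) v′ p)) (sym (++-assoc u′ (elevate β′) (v′ ++ p)))))))
      where
      nonEmpty : ∀ v → v ++ p ≢ []
      nonEmpty []      = p≢[]
      nonEmpty (_ ∷ _) ()

    ¬ascending-suffix : ∀ {x α} → x ≢ [] → Path 0 α 0 → w ≢ x ++ 𝟙 ∷ α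
    ¬ascending-suffix {[]} x≢[] _ _ = x≢[] refl
    ¬ascending-suffix {e ∷ x} {α} x≢[] pα eq =
      ¬overlapˡ
        (inj₁ (⇒A₀ [] |s|≡n [] ps (subst (⌈ n /2⌉ ≤_) (sym |s|≡n) (ℕ.⌈n/2⌉≤n n)) refl , ¬A₁))
        (mkOverlap (𝟙 ∷ α) (λ ()) (++-∷-≢[] (flat k)) x≢[]
          (cong (𝟙 ∷_) (++-assoc α (flat k) [ 𝟘 ])) eq)
      where
      k : ℕ
      -- Here `x` is the removed prefix without its first letter: one place is reserved for the
      -- final fall.
      k = length x

      ps : Path 0 (α ++ flat k) 0
      ps = pα ⁀ flat-path k

      |s|≡n : length (elevate (α ++ flat k)) ≡ n
      |s|≡n = trans (cong suc (length-++-flat-∷ʳ α k))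
        (trans (cong (λ m → suc (suc m)) (ℕ.+-comm (length α) k))
          (trans (cong suc (sym (ℕ.+-suc k (length α)))) (length-split (e ∷ x) (𝟙 ∷ α) |w|≡n eq)))

      ¬A₁ : elevate (α ++ flat k) ∉ A₁ n
      -- A word of A₁ touches the axis in its middle, but a single elevated word does so only at its
      -- ends.
      ¬A₁ a₁ with β₁ , β₂ , p₁ , _ , _ , eq ← A₁⇒ a₁
        with _ , p₁′ ← elevate-proper-prefix (β₁ ++ [ 𝟘 ]) ps eq
        with () ← end-unique (elevate-path p₁) p₁′

    ¬falling-prefix : ∀ {γ p} → Path 0 γ 0 → ¬ LongFactor γ → p ≢ [] → w ≢ (γ ++ [ 𝟘 ]) ++ p
    ¬falling-prefix {γ} {p} pγ ¬long p≢[] eq =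
      ¬overlapʳ
        (inj₂ (inj₂ (⇒C (flat k ++ γ) (length-flat-++ (γ ++ [ 𝟘 ]) {p} |w|≡n eq) (flat-path k ⁀ pγ)
          (¬long ∘ longFactor-flat-++ k) (sym (++-assoc (flat k) γ [ 𝟘 ])))))
        (mkOverlap (γ ++ [ 𝟘 ]) (++-∷-≢[] γ) p≢[] (flat≢[] p≢[]) eq refl)
      where
      k : ℕ
      k = length p

    ¬short-suffix : ∀ {x t} → x ≢ [] → t ≢ [] → Path 0 t 0 → length t < ⌈ n /2⌉ → w ≢ x ++ t
    ¬short-suffix {[]}    x≢[] _ _ _ _ = x≢[] refl
    ¬short-suffix {e ∷ x} {t} x≢[] t≢[] pt short eq =
      ¬overlapˡ
        (inj₂ (inj₂ (⇒C (t ++ flat k) |s|≡n (pt ⁀ flat-path k) (short-++-flat t k short) refl)))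
        (mkOverlap t t≢[] (++-∷-≢[] (flat k)) x≢[] (++-assoc t (flat k) [ 𝟘 ]) eq)
      where
      k : ℕ
      -- Again one letter fewer than the removed prefix, to make room for the final fall.
      k = length x

      |s|≡n : length ((t ++ flat k) ++ [ 𝟘 ]) ≡ n
      |s|≡n = trans (length-++-flat-∷ʳ t k)
        (trans (cong suc (ℕ.+-comm (length t) k)) (length-split (e ∷ x) t |w|≡n eq))

    init≢[] : ∀ {z c} → w ≡ z ++ [ c ] → z ≢ []
    init≢[] eq refl =
      ℕ.<⇒≢ (ℕ.≤-trans (s≤s (s≤s z≤n)) 3≤n) (trans (sym (cong length eq)) |w|≡n)

    ¬ends-in-fall : ∀ z {k} → Path 0 w k → w ≢ z ++ [ 𝟘 ]
    ¬ends-in-fall z pw eq with last-ascent z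
    ... | inj₁ (m , pz)
        -- The final fall must start at positive height, which needs an unmatched rise in `z`.
        with suc j , pz′ , _ ← split z (subst (λ w → Path 0 w _) eq pw)
        with () ← trans (sym (ℕ.+-suc m j)) (path-to-zero pz′ pz)
    -- The last unmatched rise of `z` is matched by the final fall, so `w` ends with `elevate α`.
    ... | inj₂ (y , α , refl , pα) = last-component (⌈ n /2⌉ ≤? length (elevate α))
      where
      eqα : w ≡ y ++ elevate α
      eqα = trans eq (++-assoc y (𝟙 ∷ α) [ 𝟘 ])

      last-component : Dec (Long (elevate α)) → ⊥
      last-component (no short) = ¬short-suffix y≢[] (λ ()) (elevate-path pα) (ℕ.≰⇒> short) eqα
        where
        y≢[] : y ≢ []
        y≢[] refl = short (subst (⌈ n /2⌉ ≤_) (trans (sym |w|≡n) (cong length eqα)) (ℕ.⌈n/2⌉≤n n))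
      last-component (yes long) with last-ascent y
      ... | inj₁ (m , py)
          with j , py′ , _ ← split y (subst (λ w → Path 0 w _) eqα pw)
          -- No suffix of `y` has positive height and no prefix has negative height, so `y` is
          -- Motzkin and `w` is in A₀.
          with refl ← ℕ.m+n≡0⇒n≡0 m (path-to-zero py′ py) =
        w∉ (inj₁ (⇒A₀ y |w|≡n py′ pα long eqα , λ a₁ →
          let _ , _ , p₁ , _ , long₁ , eq₁ = A₁⇒ a₁ in ¬long-prefix [] [] p₁ long₁ (λ ()) eq₁))
      -- If the unmatched rise is the first letter, `w` has the form of B; otherwise it begins a
      -- proper suffix of the form excluded by `¬ascending-suffix`.
      ... | inj₂ ([] , α′ , refl , pα′) = w∉ (inj₂ (inj₁ (⇒B α′ |w|≡n pα′ pα long eqα)))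
      ... | inj₂ (e ∷ x , α′ , refl , pα′) =
        ¬ascending-suffix {e ∷ x} (λ ()) (pα′ ⁀ elevate-path pα) (trans eqα (++-assoc (e ∷ x) (𝟙 ∷ α′) _))

    ¬nonNegative : ∀ {k} → ¬ Path 0 w k
    ¬nonNegative pw with unsnoc w
    ... | inj₁ eq =
      ℕ.<⇒≢ (ℕ.≤-trans (s≤s z≤n) 3≤n) (trans (sym (cong length eq)) |w|≡n)
    ¬nonNegative pw | inj₂ (z , 𝟘   , eq) = ¬ends-in-fall z pw eq
    ¬nonNegative pw | inj₂ (z , 𝟙   , eq) = ¬ascending-suffix (init≢[] eq) [] eq
    ¬nonNegative pw | inj₂ (z , ℓ c , eq) =
      -- A single level step is a short Motzkin suffix, since `3 ≤ n` gives `2 ≤ ⌈ n /2⌉`.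
      ¬short-suffix (init≢[] eq) (λ ()) (level []) (ℕ.⌈n/2⌉-mono 3≤n) eq

    impossible : ⊥
    impossible with first-descent 0 w
    ... | inj₁ (_ , pw)          = ¬nonNegative pw
    ... | inj₂ (γ , r , eq , pγ) = dips r eq
      where
      ¬long : ¬ LongFactor γ
      ¬long = ¬long-factor-prefix pγ (λ ()) eq

      dips : ∀ r → w ≢ γ ++ 𝟘 ∷ r
      dips []      eq = w∉ (inj₂ (inj₂ (⇒C γ |w|≡n pγ ¬long eq)))
      dips (_ ∷ r) eq = ¬falling-prefix pγ ¬long (λ ()) (trans eq (sym (++-assoc γ [ 𝟘 ] _)))

proposition3p2 : ∀ (q n : ℕ) (3≤q : 3 ≤ q) → 3 ≤ n →
    IsNonExpandableCrossBifixFreeSet q n (Construction.CBFS q 3≤q n)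
proposition3p2 (suc (suc (suc q))) n (s≤s (s≤s (s≤s z≤n))) 3≤n =
  CBFS-crossBifixFree , λ w (w∈BF , w∉) expanded →
    Expansion.impossible (proj₁ w∈BF) w∉ λ {s} s∈ →
      -- The condition concerns distinct words only; `w` differs from `s` because it lies outside
      -- the set.
      proj₂ expanded w s (inj₂ refl) (inj₁ s∈) λ { refl → w∉ s∈ }
  where open Sets q n 3≤n
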